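{- For any homomorphism of commutative rings $\varphi:A\to B$ and any shape $\vec s=(n_1,\dots,n_k)$ (a tuple of $k\ge1$ positive integers), there is a canonical isomorphism of simplicial $B$-modules $$\theta_\bullet: X_\bullet(\vec s;A)\otimes_AB\ \xrightarrow{\ \cong\ }\ X_\bullet(\vec s;B).$$
   Context: Notation: $[p]=\{0,\dots,p\}$. For a shape $\vec s=(n_1,\dots,n_k)$ put $n=\min(n_1,\dots,n_k)-1$, $M_a(p)=n_a-1-n+p$ (so $M_a(p)\ge p$) and $I_p=\prod_{a=1}^k[M_a(p)]$ for $p\ge 0$. Let $\delta_i^q:[q-1]\to[q]$ be the increasing injection missing $i$ and $\sigma_i^q:[q+1]\to[q]$ the nondecreasing surjection taking the value $i$ twice. Define $\Delta_i^p=\prod_{a=1}^k\delta_i^{M_a(p)}:I_{p-1}\to I_p$ ($p\ge1$, $0\le i\le p$) and $\Sigma_i^p=\prod_{a=1}^k\sigma_i^{M_a(p)}:I_{p+1}\to I_p$ ($p\ge 0$, $0\le i\le p$). For a commutative ring $A$, the diagonal simplicial tensor module $X_\bullet(\vec s;A)$ is the simplicial $A$-module with $X_p=A^{I_p}$ (all functions $T:I_p\to A$), faces $d_i^p(T)=T\circ\Delta_i^p$ and degeneracies $s_i^p(T)=T\circ\Sigma_i^p$. The tensor product with $B$ is formed degreewise. The canonical map in degree $p$ sends $E_m\otimes b$ to $b\cdot E_m$, where $E_m$ is the indicator function of $m\in I_p$. -}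

module Defs where

open import Algebra.Bundles using (AbelianGroup; CommutativeRing)
open import Algebra.Module.Bundles using (Module)
import Algebra.Module.Construct.TensorUnit as TensorUnit
open import Algebra.Module.Morphism.Structures
  using (IsModuleHomomorphism; IsModuleIsomorphism)
open import Algebra.Module.Structures using (IsLeftModule)
open import Algebra.Module.Structures.Biased using (IsModuleFromLeft)
open import Algebra.Morphism.Bundles using (RingHomomorphism)
import Algebra.Construct.Pointwise as Pointwise
import Algebra.Properties.AbelianGroup as AbelianGroupProperties
open import Data.Bool.Base using (if_then_else_)
open import Data.Fin.Base
  using (Fin; zero; suc; toℕ; inject₁; punchIn; pinch; _↑ˡ_; _≤_; _<_)
open import Data.Fin.Properties using (toℕ-↑ˡ) renaming (_≟_ to _≟ᶠ_)
open import Data.Nat.Base using (ℕ; zero; suc; s≤s; _+_; _∸_; _⊓_; NonZero)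
import Data.Nat.Base as ℕ
open import Data.Product.Base using (_,_; uncurry)
open import Data.Vec.Base using (Vec; []; _∷_; foldr₁)
open import Data.Vec.Relation.Unary.All as All using (All; []; _∷_)
open import Function.Base using (_∘_; id; flip)
open import Level using (Level; _⊔_)
open import Relation.Binary.Definitions using (DecidableEquality)
open import Relation.Binary.PropositionalEquality.Core
  using (_≡_; refl; sym; trans; cong; cong₂; subst₂)
open import Relation.Nullary.Decidable using (does; yes; map′; _×-dec_)

IsLinear : ∀ {r ℓr m ℓm n ℓn : Level} {R : CommutativeRing r ℓr}
           (M : Module R m ℓm) (N : Module R n ℓn) →
           (Module.Carrierᴹ M → Module.Carrierᴹ N) → Set (r ⊔ m ⊔ ℓm ⊔ ℓn)
IsLinear M N = IsModuleHomomorphism (Module.rawModule M) (Module.rawModule N)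

IsLinearIso : ∀ {r ℓr m ℓm n ℓn : Level} {R : CommutativeRing r ℓr}
              (M : Module R m ℓm) (N : Module R n ℓn) →
              (Module.Carrierᴹ M → Module.Carrierᴹ N) →
              Set (r ⊔ m ⊔ n ⊔ ℓm ⊔ ℓn)
IsLinearIso M N = IsModuleIsomorphism (Module.rawModule M) (Module.rawModule N)

-- Over a commutative ring the right action is determined by the left one.
linear : ∀ {r ℓr m ℓm n ℓn : Level} {R : CommutativeRing r ℓr}
         (M : Module R m ℓm) (N : Module R n ℓn) →
         let open CommutativeRing R using (Carrier)
             module M = Module M
             module N = Module N
         in {f : M.Carrierᴹ → N.Carrierᴹ} →
         (∀ {x y} → x M.≈ᴹ y → f x N.≈ᴹ f y) →
         (∀ x y → f (x M.+ᴹ y) N.≈ᴹ f x N.+ᴹ f y) →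
         f M.0ᴹ N.≈ᴹ N.0ᴹ →
         (∀ x → f (M.-ᴹ x) N.≈ᴹ N.-ᴹ f x) →
         (∀ (c : Carrier) x → f (c M.*ₗ x) N.≈ᴹ c N.*ₗ f x) →
         IsLinear M N f
linear M N {f} f-cong f-+ f-0 f-neg f-* = record
  { isBimoduleHomomorphism = record
    { +ᴹ-isGroupHomomorphism = record
      { isMonoidHomomorphism = record
        { isMagmaHomomorphism = record
          { isRelHomomorphism = record { cong = f-cong }
          ; homo = f-+
          }
        ; ε-homo = f-0
        }
      ; ⁻¹-homo = f-neg
      }
    ; *ₗ-homo = f-*
    ; *ᵣ-homo = λ c x → N.≈ᴹ-trans
        (f-cong (M.≈ᴹ-sym (M.*ₗ-*ᵣ-coincident c x)))
        (N.≈ᴹ-trans (f-* c x) (N.*ₗ-*ᵣ-coincident c (f x)))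
    }
  }
  where
  module M = Module M
  module N = Module N

functionModule : ∀ {r ℓr : Level} (R : CommutativeRing r ℓr) → Set →
                 Module R r ℓr
functionModule R I = record
  { Carrierᴹ = I → R.Carrier
  ; _≈ᴹ_     = λ S T → ∀ i → S i R.≈ T i
  ; _+ᴹ_     = λ S T i → S i R.+ T i
  ; _*ₗ_     = λ c T i → c R.* T i
  ; _*ᵣ_     = λ T c i → c R.* T i
  ; 0ᴹ       = λ _ → R.0#
  ; -ᴹ_      = λ T i → R.- T i
  ; isModule = IsModuleFromLeft.isModule (record { isLeftModule = isLeft })
  }
  where
  module R = CommutativeRing R
  isLeft : IsLeftModule R.ring _ _ _ _ _
  isLeft = record
    { isLeftSemimodule = record
      { +ᴹ-isCommutativeMonoid =
          Pointwise.isCommutativeMonoid I R.+-isCommutativeMonoid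
      ; isPreleftSemimodule = record
        { *ₗ-cong      = λ p q i → R.*-cong p (q i)
        ; *ₗ-zeroˡ     = λ T i → R.zeroˡ (T i)
        ; *ₗ-distribʳ  = λ T c d i → R.distribʳ (T i) c d
        ; *ₗ-identityˡ = λ T i → R.*-identityˡ (T i)
        ; *ₗ-assoc     = λ c d T i → R.*-assoc c d (T i)
        ; *ₗ-zeroʳ     = λ c _ → R.zeroʳ c
        ; *ₗ-distribˡ  = λ c S T i → R.distribˡ c (S i) (T i)
        }
      }
    ; -ᴹ‿cong    = λ p i → R.-‿cong (p i)
    ; -ᴹ‿inverse = (λ T i → R.-‿inverseˡ (T i)) , (λ T i → R.-‿inverseʳ (T i))
    }

restrictScalars :
  ∀ {a ℓa b ℓb m ℓm : Level}
    {A : CommutativeRing a ℓa} {B : CommutativeRing b ℓb} →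
  RingHomomorphism (CommutativeRing.rawRing A) (CommutativeRing.rawRing B) →
  Module B m ℓm → Module A m ℓm
restrictScalars {A = A} φ N = record
  { Carrierᴹ = N.Carrierᴹ
  ; _≈ᴹ_     = N._≈ᴹ_
  ; _+ᴹ_     = N._+ᴹ_
  ; _*ₗ_     = λ c x → φ.⟦ c ⟧ N.*ₗ x
  ; _*ᵣ_     = λ x c → φ.⟦ c ⟧ N.*ₗ x
  ; 0ᴹ       = N.0ᴹ
  ; -ᴹ_      = N.-ᴹ_
  ; isModule = IsModuleFromLeft.isModule (record { isLeftModule = isLeft })
  }
  where
  module A = CommutativeRing A
  module N = Module N
  module φ = RingHomomorphism φ
  isLeft : IsLeftModule A.ring _ _ _ _ _
  isLeft = record
    { isLeftSemimodule = record
      { +ᴹ-isCommutativeMonoid = N.+ᴹ-isCommutativeMonoid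
      ; isPreleftSemimodule = record
        { *ₗ-cong      = λ p q → N.*ₗ-cong (φ.⟦⟧-cong p) q
        ; *ₗ-zeroˡ     = λ x →
            N.≈ᴹ-trans (N.*ₗ-cong φ.0#-homo N.≈ᴹ-refl) (N.*ₗ-zeroˡ x)
        ; *ₗ-distribʳ  = λ x c d →
            N.≈ᴹ-trans (N.*ₗ-cong (φ.+-homo c d) N.≈ᴹ-refl) (N.*ₗ-distribʳ x _ _)
        ; *ₗ-identityˡ = λ x →
            N.≈ᴹ-trans (N.*ₗ-cong φ.1#-homo N.≈ᴹ-refl) (N.*ₗ-identityˡ x)
        ; *ₗ-assoc     = λ c d x →
            N.≈ᴹ-trans (N.*ₗ-cong (φ.*-homo c d) N.≈ᴹ-refl) (N.*ₗ-assoc _ _ x)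
        ; *ₗ-zeroʳ     = λ c → N.*ₗ-zeroʳ _
        ; *ₗ-distribˡ  = λ c → N.*ₗ-distribˡ _
        }
      }
    ; -ᴹ‿cong    = N.-ᴹ‿cong
    ; -ᴹ‿inverse = N.-ᴹ‿inverse
    }

-- The abelian group M ⊗_R N, presented by the generators x ⊗ y subject to
-- biadditivity and R-balancedness.  The equality _≋_ is the least abelian
-- group congruence containing these relations.

module TensorProduct {r ℓr m ℓm n ℓn : Level} {R : CommutativeRing r ℓr}
                     (M : Module R m ℓm) (N : Module R n ℓn) where

  private
    module R = CommutativeRing R
    module M = Module M
    module N = Module N

  infixl 7 _⊗_
  infixl 6 _⊞_
  infix  8 ⊟_
  infix  4 _≋_

  data Tensor : Set (m ⊔ n) where
    _⊗_ : M.Carrierᴹ → N.Carrierᴹ → Tensor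
    _⊞_ : Tensor → Tensor → Tensor
    𝟎   : Tensor
    ⊟_  : Tensor → Tensor

  data _≋_ : Tensor → Tensor → Set (r ⊔ m ⊔ ℓm ⊔ n ⊔ ℓn) where
    ≋-refl  : ∀ {t} → t ≋ t
    ≋-sym   : ∀ {t u} → t ≋ u → u ≋ t
    ≋-trans : ∀ {t u v} → t ≋ u → u ≋ v → t ≋ v

    ⊗-cong  : ∀ {x x′ y y′} → x M.≈ᴹ x′ → y N.≈ᴹ y′ → x ⊗ y ≋ x′ ⊗ y′
    ⊞-cong  : ∀ {t t′ u u′} → t ≋ t′ → u ≋ u′ → t ⊞ u ≋ t′ ⊞ u′
    ⊟-cong  : ∀ {t t′} → t ≋ t′ → ⊟ t ≋ ⊟ t′

    ⊞-assoc     : ∀ t u v → (t ⊞ u) ⊞ v ≋ t ⊞ (u ⊞ v)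
    ⊞-comm      : ∀ t u → t ⊞ u ≋ u ⊞ t
    ⊞-identityˡ : ∀ t → 𝟎 ⊞ t ≋ t
    ⊞-inverseˡ  : ∀ t → ⊟ t ⊞ t ≋ 𝟎

    ⊗-distribʳ : ∀ x x′ y → (x M.+ᴹ x′) ⊗ y ≋ x ⊗ y ⊞ x′ ⊗ y
    ⊗-distribˡ : ∀ x y y′ → x ⊗ (y N.+ᴹ y′) ≋ x ⊗ y ⊞ x ⊗ y′
    ⊗-balanced : ∀ (c : R.Carrier) x y → (c M.*ₗ x) ⊗ y ≋ x ⊗ (c N.*ₗ y)

  abelianGroup : AbelianGroup (m ⊔ n) (r ⊔ m ⊔ ℓm ⊔ n ⊔ ℓn)
  abelianGroup = record
    { Carrier = Tensor
    ; _≈_     = _≋_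
    ; _∙_     = _⊞_
    ; ε       = 𝟎
    ; _⁻¹     = ⊟_
    ; isAbelianGroup = record
      { isGroup = record
        { isMonoid = record
          { isSemigroup = record
            { isMagma = record
              { isEquivalence = record
                { refl = ≋-refl ; sym = ≋-sym ; trans = ≋-trans }
              ; ∙-cong = ⊞-cong
              }
            ; assoc = ⊞-assoc
            }
          ; identity = ⊞-identityˡ
                     , λ t → ≋-trans (⊞-comm t 𝟎) (⊞-identityˡ t)
          }
        ; inverse = ⊞-inverseˡ
                  , λ t → ≋-trans (⊞-comm t (⊟ t)) (⊞-inverseˡ t)
        ; ⁻¹-cong = ⊟-cong
        }
      ; comm = ⊞-comm
      }
    }

open TensorProduct using (Tensor; _⊗_; _⊞_; 𝟎; ⊟_)

module _ {r ℓr m ℓm m′ ℓm′ n ℓn n′ ℓn′ : Level} {R : CommutativeRing r ℓr}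
         (M : Module R m ℓm) (M′ : Module R m′ ℓm′)
         (N : Module R n ℓn) (N′ : Module R n′ ℓn′) where

  private
    module S = TensorProduct M N
    module T = TensorProduct M′ N′

  tensorMap : (Module.Carrierᴹ M → Module.Carrierᴹ M′) →
              (Module.Carrierᴹ N → Module.Carrierᴹ N′) → S.Tensor → T.Tensor
  tensorMap f g (x S.⊗ y) = f x T.⊗ g y
  tensorMap f g (t S.⊞ u) = tensorMap f g t T.⊞ tensorMap f g u
  tensorMap f g S.𝟎       = T.𝟎
  tensorMap f g (S.⊟ t)   = T.⊟ tensorMap f g t

  tensorMap-cong : ∀ {f g} → IsLinear M M′ f → IsLinear N N′ g →
                   ∀ {t u} → t S.≋ u → tensorMap f g t T.≋ tensorMap f g u
  tensorMap-cong {f} {g} f-lin g-lin = go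
    where
    module f = IsModuleHomomorphism f-lin
    module g = IsModuleHomomorphism g-lin
    module M′ = Module M′
    module N′ = Module N′
    go : ∀ {t u} → t S.≋ u → tensorMap f g t T.≋ tensorMap f g u
    go S.≋-refl             = T.≋-refl
    go (S.≋-sym p)          = T.≋-sym (go p)
    go (S.≋-trans p q)      = T.≋-trans (go p) (go q)
    go (S.⊗-cong p q)       = T.⊗-cong (f.⟦⟧-cong p) (g.⟦⟧-cong q)
    go (S.⊞-cong p q)       = T.⊞-cong (go p) (go q)
    go (S.⊟-cong p)         = T.⊟-cong (go p)
    go (S.⊞-assoc t u v)    = T.⊞-assoc _ _ _
    go (S.⊞-comm t u)       = T.⊞-comm _ _
    go (S.⊞-identityˡ t)    = T.⊞-identityˡ _
    go (S.⊞-inverseˡ t)     = T.⊞-inverseˡ _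
    go (S.⊗-distribʳ x y z) =
      T.≋-trans (T.⊗-cong (f.+ᴹ-homo x y) N′.≈ᴹ-refl) (T.⊗-distribʳ _ _ _)
    go (S.⊗-distribˡ x y z) =
      T.≋-trans (T.⊗-cong M′.≈ᴹ-refl (g.+ᴹ-homo y z)) (T.⊗-distribˡ _ _ _)
    go (S.⊗-balanced c x y) =
      T.≋-trans (T.⊗-cong (f.*ₗ-homo c x) N′.≈ᴹ-refl)
        (T.≋-trans (T.⊗-balanced c _ _)
          (T.⊗-cong M′.≈ᴹ-refl (N′.≈ᴹ-sym (g.*ₗ-homo c y))))

module BaseChange {a ℓa b ℓb : Level}
  {A : CommutativeRing a ℓa} {B : CommutativeRing b ℓb}
  (φ : RingHomomorphism (CommutativeRing.rawRing A) (CommutativeRing.rawRing B))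
  where

  private
    module B = CommutativeRing B
    module φ = RingHomomorphism φ

  B-as-A-module : Module A b ℓb
  B-as-A-module = restrictScalars φ (TensorUnit.⟨module⟩ {R = B})

  mult-linear : ∀ c → IsLinear B-as-A-module B-as-A-module (c B.*_)
  mult-linear c = linear B-as-A-module B-as-A-module
    B.*-congˡ
    (B.distribˡ c)
    (B.zeroʳ c)
    (λ x → B.sym (-‿distribʳ-* c x))
    (λ d x → B.trans (B.sym (B.*-assoc c φ.⟦ d ⟧ x))
      (B.trans (B.*-congʳ (B.*-comm c φ.⟦ d ⟧)) (B.*-assoc φ.⟦ d ⟧ c x)))
    where
    open import Algebra.Properties.Ring B.ring using (-‿distribʳ-*)

  module _ {m ℓm : Level} (M : Module A m ℓm) where

    private
      module M = Module M
      module T = TensorProduct M B-as-A-module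
      open AbelianGroup T.abelianGroup using (isCommutativeMonoid; inverse; ∙-congʳ)
      open AbelianGroupProperties T.abelianGroup
        using (identityˡ-unique; ε⁻¹≈ε; ⁻¹-∙-comm)
      open import Algebra.Properties.CommutativeSemigroup
        (AbelianGroup.commutativeSemigroup T.abelianGroup) using (interchange)

      _·_ : B.Carrier → T.Tensor → T.Tensor
      c · t = tensorMap M M B-as-A-module B-as-A-module id (c B.*_) t

      ·-congˡ : ∀ c {t u} → t T.≋ u → (c · t) T.≋ (c · u)
      ·-congˡ c = tensorMap-cong M M B-as-A-module B-as-A-module
        (linear M M id (λ _ _ → M.≈ᴹ-refl) M.≈ᴹ-refl (λ _ → M.≈ᴹ-refl)
          (λ _ _ → M.≈ᴹ-refl))
        (mult-linear c)

      ·-congʳ : ∀ {c d} t → c B.≈ d → (c · t) T.≋ (d · t)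
      ·-congʳ (x T.⊗ y) p = T.⊗-cong M.≈ᴹ-refl (B.*-congʳ p)
      ·-congʳ (t T.⊞ u) p = T.⊞-cong (·-congʳ t p) (·-congʳ u p)
      ·-congʳ T.𝟎       p = T.≋-refl
      ·-congʳ (T.⊟ t)   p = T.⊟-cong (·-congʳ t p)

      x⊗0 : ∀ x → x T.⊗ B.0# T.≋ T.𝟎
      x⊗0 x = identityˡ-unique _ (x T.⊗ B.0#)
        (T.≋-trans (T.≋-sym (T.⊗-distribˡ x B.0# B.0#))
          (T.⊗-cong M.≈ᴹ-refl (B.+-identityˡ B.0#)))

      ·-zeroˡ : ∀ t → (B.0# · t) T.≋ T.𝟎
      ·-zeroˡ (x T.⊗ y) =
        T.≋-trans (T.⊗-cong M.≈ᴹ-refl (B.zeroˡ y)) (x⊗0 x)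
      ·-zeroˡ (t T.⊞ u) =
        T.≋-trans (T.⊞-cong (·-zeroˡ t) (·-zeroˡ u)) (T.⊞-identityˡ T.𝟎)
      ·-zeroˡ T.𝟎       = T.≋-refl
      ·-zeroˡ (T.⊟ t)   = T.≋-trans (T.⊟-cong (·-zeroˡ t)) ε⁻¹≈ε

      ·-distribʳ : ∀ t c d → ((c B.+ d) · t) T.≋ (c · t) T.⊞ (d · t)
      ·-distribʳ (x T.⊗ y) c d =
        T.≋-trans (T.⊗-cong M.≈ᴹ-refl (B.distribʳ y c d)) (T.⊗-distribˡ x _ _)
      ·-distribʳ (t T.⊞ u) c d =
        T.≋-trans (T.⊞-cong (·-distribʳ t c d) (·-distribʳ u c d))
          (interchange _ _ _ _)
      ·-distribʳ T.𝟎       c d = T.≋-sym (T.⊞-identityˡ T.𝟎)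
      ·-distribʳ (T.⊟ t)   c d =
        T.≋-trans (T.⊟-cong (·-distribʳ t c d)) (T.≋-sym (⁻¹-∙-comm _ _))

      ·-identityˡ : ∀ t → (B.1# · t) T.≋ t
      ·-identityˡ (x T.⊗ y) = T.⊗-cong M.≈ᴹ-refl (B.*-identityˡ y)
      ·-identityˡ (t T.⊞ u) = T.⊞-cong (·-identityˡ t) (·-identityˡ u)
      ·-identityˡ T.𝟎       = T.≋-refl
      ·-identityˡ (T.⊟ t)   = T.⊟-cong (·-identityˡ t)

      ·-assoc : ∀ c d t → ((c B.* d) · t) T.≋ (c · (d · t))
      ·-assoc c d (x T.⊗ y) = T.⊗-cong M.≈ᴹ-refl (B.*-assoc c d y)
      ·-assoc c d (t T.⊞ u) = T.⊞-cong (·-assoc c d t) (·-assoc c d u)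
      ·-assoc c d T.𝟎       = T.≋-refl
      ·-assoc c d (T.⊟ t)   = T.⊟-cong (·-assoc c d t)

      isLeft : IsLeftModule B.ring T._≋_ T._⊞_ T.𝟎 T.⊟_ _·_
      isLeft = record
        { isLeftSemimodule = record
          { +ᴹ-isCommutativeMonoid = isCommutativeMonoid
          ; isPreleftSemimodule = record
            { *ₗ-cong      = λ {c} {d} {t} p q →
                T.≋-trans (·-congʳ t p) (·-congˡ d q)
            ; *ₗ-zeroˡ     = ·-zeroˡ
            ; *ₗ-distribʳ  = ·-distribʳ
            ; *ₗ-identityˡ = ·-identityˡ
            ; *ₗ-assoc     = ·-assoc
            ; *ₗ-zeroʳ     = λ _ → T.≋-refl
            ; *ₗ-distribˡ  = λ _ _ _ → T.≋-refl
            }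
          }
        ; -ᴹ‿cong    = T.⊟-cong
        ; -ᴹ‿inverse = inverse
        }

    -- M ⊗_A B, where c · (x ⊗ y) = x ⊗ (c * y).
    baseChange : Module B (m ⊔ b) (a ⊔ m ⊔ ℓm ⊔ b ⊔ ℓb)
    baseChange = record
      { Carrierᴹ = T.Tensor
      ; _≈ᴹ_     = T._≋_
      ; _+ᴹ_     = T._⊞_
      ; _*ₗ_     = _·_
      ; _*ᵣ_     = flip _·_
      ; 0ᴹ       = T.𝟎
      ; -ᴹ_      = T.⊟_
      ; isModule = IsModuleFromLeft.isModule (record { isLeftModule = isLeft })
      }

  module _ {m ℓm m′ ℓm′ : Level} (M : Module A m ℓm) (M′ : Module A m′ ℓm′) where

    private
      module M = Module M
      module M′ = Module M′
      module M′⊗B = Module (baseChange M′)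
      module S = TensorProduct M B-as-A-module
      module T = TensorProduct M′ B-as-A-module

    baseChangeMap : (M.Carrierᴹ → M′.Carrierᴹ) → S.Tensor → T.Tensor
    baseChangeMap f = tensorMap M M′ B-as-A-module B-as-A-module f id

    baseChangeMap-linear : ∀ {f} → IsLinear M M′ f →
      IsLinear (baseChange M) (baseChange M′) (baseChangeMap f)
    baseChangeMap-linear {f} f-lin = linear (baseChange M) (baseChange M′)
      (tensorMap-cong M M′ B-as-A-module B-as-A-module f-lin
        (linear B-as-A-module B-as-A-module id (λ _ _ → B.refl) B.refl
          (λ _ → B.refl) (λ _ _ → B.refl)))
      (λ _ _ → T.≋-refl) T.≋-refl (λ _ → T.≋-refl) commutes
      where
      commutes : ∀ c t → baseChangeMap f (Module._*ₗ_ (baseChange M) c t)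
                         T.≋ (c M′⊗B.*ₗ baseChangeMap f t)
      commutes c (x S.⊗ y) = T.≋-refl
      commutes c (t S.⊞ u) = T.⊞-cong (commutes c t) (commutes c u)
      commutes c S.𝟎       = T.≋-refl
      commutes c (S.⊟ t)   = T.⊟-cong (commutes c t)

-- The face d i and the degeneracy s i on X p are indexed by i ∈ [p].  In the
-- simplicial identities the strict side conditions are absorbed into suc: for
-- example d_i d_j = d_{j-1} d_i for i < j is stated with suc j in place of j
-- and i ≤ j.  inject₁ keeps the value of an index and only enlarges its range.

record SimplicialModule {r ℓr : Level} (R : CommutativeRing r ℓr) (m ℓm : Level)
                        : Set (r ⊔ ℓr ⊔ Level.suc (m ⊔ ℓm)) where
  field
    X : ℕ → Module R m ℓm

  open module Xₚ {p : ℕ} = Module (X p) public using () renaming (_≈ᴹ_ to _≈_)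

  Carrier : ℕ → Set m
  Carrier p = Module.Carrierᴹ (X p)

  field
    d : ∀ {p} → Fin (2 + p) → Carrier (suc p) → Carrier p
    s : ∀ {p} → Fin (suc p) → Carrier p → Carrier (suc p)

    d-linear : ∀ {p} (i : Fin (2 + p)) → IsLinear (X (suc p)) (X p) (d i)
    s-linear : ∀ {p} (i : Fin (suc p)) → IsLinear (X p) (X (suc p)) (s i)

    d-d : ∀ {p} (i j : Fin (2 + p)) → i ≤ j → (x : Carrier (2 + p)) →
          d i (d (suc j) x) ≈ d j (d (inject₁ i) x)

    s-s : ∀ {p} (i j : Fin (suc p)) → i ≤ j → (x : Carrier p) →
          s (inject₁ i) (s j x) ≈ s (suc j) (s i x)

    d-s-< : ∀ {p} (i : Fin (2 + p)) (j : Fin (suc p)) → i ≤ j →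
            (x : Carrier (suc p)) →
            d (inject₁ i) (s (suc j) x) ≈ s j (d i x)

    d-s-≡ : ∀ {p} (j : Fin (suc p)) (x : Carrier p) → d (inject₁ j) (s j x) ≈ x
    d-s-suc : ∀ {p} (j : Fin (suc p)) (x : Carrier p) → d (suc j) (s j x) ≈ x

    d-s-> : ∀ {p} (i : Fin (2 + p)) (j : Fin (suc p)) → j < i →
            (x : Carrier (suc p)) →
            d (suc i) (s (inject₁ j) x) ≈ s j (d i x)

record _≅_ {r ℓr m ℓm n ℓn : Level} {R : CommutativeRing r ℓr}
           (X : SimplicialModule R m ℓm) (Y : SimplicialModule R n ℓn)
           : Set (r ⊔ m ⊔ ℓm ⊔ n ⊔ ℓn) where
  private
    module X = SimplicialModule X
    module Y = SimplicialModule Y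
  field
    θ     : ∀ p → X.Carrier p → Y.Carrier p
    θ-iso : ∀ p → IsLinearIso (X.X p) (Y.X p) (θ p)
    θ-d   : ∀ {p} (i : Fin (2 + p)) (x : X.Carrier (suc p)) →
            θ p (X.d i x) Y.≈ Y.d i (θ (suc p) x)
    θ-s   : ∀ {p} (i : Fin (suc p)) (x : X.Carrier p) →
            θ (suc p) (X.s i x) Y.≈ Y.s i (θ p x)

module _ {a ℓa b ℓb m ℓm : Level}
  {A : CommutativeRing a ℓa} {B : CommutativeRing b ℓb} where

  _⊗[_] : SimplicialModule A m ℓm →
    RingHomomorphism (CommutativeRing.rawRing A) (CommutativeRing.rawRing B) →
    SimplicialModule B (m ⊔ b) (a ⊔ m ⊔ ℓm ⊔ b ⊔ ℓb)
  X ⊗[ φ ] = record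
    { X        = λ p → baseChange (X.X p)
    ; d        = λ i → mapᴮ (X.d i)
    ; s        = λ i → mapᴮ (X.s i)
    ; d-linear = λ i → baseChangeMap-linear (X.X _) (X.X _) (X.d-linear i)
    ; s-linear = λ i → baseChangeMap-linear (X.X _) (X.X _) (X.s-linear i)
    ; d-d      = λ i j p → square (X.d-d i j p)
    ; s-s      = λ i j p → square (X.s-s i j p)
    ; d-s-<    = λ i j p → square (X.d-s-< i j p)
    ; d-s-≡    = λ j → retract (X.d-s-≡ j)
    ; d-s-suc  = λ j → retract (X.d-s-suc j)
    ; d-s->    = λ i j p → square (X.d-s-> i j p)
    }
    where
    module X = SimplicialModule X
    module B = CommutativeRing B
    open BaseChange φ
    module T (p : ℕ) = TensorProduct (X.X p) B-as-A-module

    mapᴮ : ∀ {p q} → (X.Carrier p → X.Carrier q) → T.Tensor p → T.Tensor q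
    mapᴮ {p} {q} = baseChangeMap (X.X p) (X.X q)

    square : ∀ {p q q′ u} {f : X.Carrier q → X.Carrier u}
             {g : X.Carrier p → X.Carrier q} {f′ : X.Carrier q′ → X.Carrier u}
             {g′ : X.Carrier p → X.Carrier q′} →
             (∀ x → f (g x) X.≈ f′ (g′ x)) →
             ∀ t → T._≋_ u (mapᴮ f (mapᴮ g t)) (mapᴮ f′ (mapᴮ g′ t))
    square e (x ⊗ y) = TensorProduct.⊗-cong (e x) B.refl
    square e (t ⊞ u) = TensorProduct.⊞-cong (square e t) (square e u)
    square e 𝟎       = TensorProduct.≋-refl
    square e (⊟ t)   = TensorProduct.⊟-cong (square e t)

    retract : ∀ {p q} {f : X.Carrier q → X.Carrier p}
              {g : X.Carrier p → X.Carrier q} → (∀ x → f (g x) X.≈ x) →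
              ∀ t → T._≋_ p (mapᴮ f (mapᴮ g t)) t
    retract e (x ⊗ y) = TensorProduct.⊗-cong (e x) B.refl
    retract e (t ⊞ u) = TensorProduct.⊞-cong (retract e t) (retract e u)
    retract e 𝟎       = TensorProduct.≋-refl
    retract e (⊟ t)   = TensorProduct.⊟-cong (retract e t)

private
  δ-δ : ∀ {n} (i j : Fin (suc n)) → i ≤ j → ∀ x →
        punchIn (suc j) (punchIn i x) ≡ punchIn (inject₁ i) (punchIn j x)
  δ-δ zero    j       _       x       = refl
  δ-δ (suc i) (suc j) (s≤s p) zero    = refl
  δ-δ (suc i) (suc j) (s≤s p) (suc x) = cong suc (δ-δ i j p x)

  σ-σ : ∀ {n} (i j : Fin n) → i ≤ j → ∀ x →
        pinch j (pinch (inject₁ i) x) ≡ pinch i (pinch (suc j) x)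
  σ-σ zero    zero    _       zero          = refl
  σ-σ zero    zero    _       (suc x)       = refl
  σ-σ zero    (suc j) _       zero          = refl
  σ-σ zero    (suc j) _       (suc x)       = refl
  σ-σ (suc i) (suc j) (s≤s p) zero          = refl
  σ-σ (suc i) (suc j) (s≤s p) (suc x)       = cong suc (σ-σ i j p x)

  σ-δ-< : ∀ {n} (i : Fin (suc n)) (j : Fin n) → i ≤ j → ∀ x →
          pinch (suc j) (punchIn (inject₁ i) x) ≡ punchIn i (pinch j x)
  σ-δ-< zero    j       _       x       = refl
  σ-δ-< (suc i) (suc j) (s≤s p) zero    = refl
  σ-δ-< (suc i) (suc j) (s≤s p) (suc x) = cong suc (σ-δ-< i j p x)

  σ-δ-≡ : ∀ {n} (j : Fin n) x → pinch j (punchIn (inject₁ j) x) ≡ x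
  σ-δ-≡ zero    x       = refl
  σ-δ-≡ (suc j) zero    = refl
  σ-δ-≡ (suc j) (suc x) = cong suc (σ-δ-≡ j x)

  σ-δ-suc : ∀ {n} (j : Fin n) x → pinch j (punchIn (suc j) x) ≡ x
  σ-δ-suc zero    zero    = refl
  σ-δ-suc zero    (suc x) = refl
  σ-δ-suc (suc j) zero    = refl
  σ-δ-suc (suc j) (suc x) = cong suc (σ-δ-suc j x)

  σ-δ-> : ∀ {n} (i : Fin (suc n)) (j : Fin n) → j < i → ∀ x →
          pinch (inject₁ j) (punchIn (suc i) x) ≡ punchIn i (pinch j x)
  σ-δ-> (suc i) zero    _       zero    = refl
  σ-δ-> (suc i) zero    _       (suc x) = refl
  σ-δ-> (suc i) (suc j) (s≤s p) zero    = refl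
  σ-δ-> (suc i) (suc j) (s≤s p) (suc x) = cong suc (σ-δ-> i j p x)

  inject₁-↑ˡ : ∀ {n} (i : Fin n) c → inject₁ i ↑ˡ c ≡ inject₁ (i ↑ˡ c)
  inject₁-↑ˡ zero    c = refl
  inject₁-↑ˡ (suc i) c = cong suc (inject₁-↑ˡ i c)

  ↑ˡ-≤ : ∀ {n n′} (i : Fin n) (j : Fin n′) c → i ≤ j → (i ↑ˡ c) ≤ (j ↑ˡ c)
  ↑ˡ-≤ i j c = subst₂ ℕ._≤_ (sym (toℕ-↑ˡ i c)) (sym (toℕ-↑ˡ j c))

  ↑ˡ-< : ∀ {n n′} (i : Fin n) (j : Fin n′) c → i < j → (i ↑ˡ c) < (j ↑ˡ c)
  ↑ˡ-< i j c = subst₂ ℕ._<_ (sym (toℕ-↑ˡ i c)) (sym (toℕ-↑ˡ j c))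

record Shape : Set where
  field
    {order-1} : ℕ
    sizes     : Vec ℕ (suc order-1)
    positive  : All NonZero sizes

module Diagonal (shape : Shape) where

  open Shape shape

  n : ℕ
  n = foldr₁ _⊓_ sizes ∸ 1

  -- By positivity 1 ≤ n + 1 ≤ nₐ for every entry, so no subtraction truncates.
  excess : ℕ → ℕ
  excess nₐ = nₐ ∸ 1 ∸ n

  -- The summand p comes first so that M (suc p) nₐ reduces to suc (M p nₐ).
  M : ℕ → ℕ → ℕ
  M p nₐ = p + excess nₐ

  Index : ℕ → Set
  Index p = All (λ nₐ → Fin (suc (M p nₐ))) sizes

  -- punchIn i is δ_i and pinch i is σ_i; in each factor the index i ∈ [p] is
  -- read as an element of [M p nₐ] ⊇ [p].
  Δ : ∀ {p} → Fin (2 + p) → Index p → Index (suc p)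
  Δ i = All.map (λ {nₐ} → punchIn (i ↑ˡ excess nₐ))

  Σ : ∀ {p} → Fin (suc p) → Index (suc p) → Index p
  Σ i = All.map (λ {nₐ} → pinch (i ↑ˡ excess nₐ))

  infix 4 _≟_

  _≟_ : ∀ {p} → DecidableEquality (Index p)
  _≟_ = go
    where
    go : ∀ {p k} {v : Vec ℕ k} →
         DecidableEquality (All (λ nₐ → Fin (suc (M p nₐ))) v)
    go []       []       = yes refl
    go (x ∷ xs) (y ∷ ys) =
      map′ (uncurry (cong₂ _∷_)) (λ { refl → refl , refl }) (x ≟ᶠ y ×-dec go xs ys)

  private
    square : ∀ {k} {v : Vec ℕ k} {P Q Q′ U : ℕ → Set}
             {f : ∀ {x} → Q x → U x} {g : ∀ {x} → P x → Q x}
             {f′ : ∀ {x} → Q′ x → U x} {g′ : ∀ {x} → P x → Q′ x} →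
             (∀ {x} (y : P x) → f (g y) ≡ f′ (g′ y)) →
             (m : All P v) →
             All.map {Q = U} f (All.map {Q = Q} g m)
             ≡ All.map {Q = U} f′ (All.map {Q = Q′} g′ m)
    square e []       = refl
    square e (y ∷ ys) = cong₂ _∷_ (e y) (square e ys)

    retract : ∀ {k} {v : Vec ℕ k} {P Q : ℕ → Set}
              {f : ∀ {x} → Q x → P x} {g : ∀ {x} → P x → Q x} →
              (∀ {x} (y : P x) → f (g y) ≡ y) →
              (m : All P v) → All.map {Q = P} f (All.map {Q = Q} g m) ≡ m
    retract e []       = refl
    retract e (y ∷ ys) = cong₂ _∷_ (e y) (retract e ys)

  module _ {r ℓr : Level} (R : CommutativeRing r ℓr) where

    private
      module R = CommutativeRing R

      resp : ∀ {p} (T : Index p → R.Carrier) {l m : Index p} →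
             l ≡ m → T l R.≈ T m
      resp T e = R.reflexive (cong T e)

    E : ∀ {p} → Index p → Index p → R.Carrier
    E m l = if does (m ≟ l) then R.1# else R.0#

    X• : SimplicialModule R r ℓr
    X• = record
      { X = λ p → functionModule R (Index p)
      ; d = λ i T → T ∘ Δ i
      ; s = λ i T → T ∘ Σ i
      ; d-linear = λ i → precomposition (Δ i)
      ; s-linear = λ i → precomposition (Σ i)
      ; d-d = λ i j i≤j T m → resp T (square
          (λ {nₐ} y → trans
            (δ-δ (i ↑ˡ excess nₐ) (j ↑ˡ excess nₐ) (↑ˡ-≤ i j _ i≤j) y)
            (cong (λ k → punchIn k (punchIn (j ↑ˡ excess nₐ) y))
              (sym (inject₁-↑ˡ i (excess nₐ))))) m)
      ; s-s = λ i j i≤j T m → resp T (square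
          (λ {nₐ} y → trans
            (cong (λ k → pinch (j ↑ˡ excess nₐ) (pinch k y))
              (inject₁-↑ˡ i (excess nₐ)))
            (σ-σ (i ↑ˡ excess nₐ) (j ↑ˡ excess nₐ) (↑ˡ-≤ i j _ i≤j) y)) m)
      ; d-s-< = λ i j i≤j T m → resp T (square
          (λ {nₐ} y → trans
            (cong (λ k → pinch (suc (j ↑ˡ excess nₐ)) (punchIn k y))
              (inject₁-↑ˡ i (excess nₐ)))
            (σ-δ-< (i ↑ˡ excess nₐ) (j ↑ˡ excess nₐ) (↑ˡ-≤ i j _ i≤j) y)) m)
      ; d-s-≡ = λ j T m → resp T (retract
          (λ {nₐ} y → trans
            (cong (λ k → pinch (j ↑ˡ excess nₐ) (punchIn k y))
              (inject₁-↑ˡ j (excess nₐ)))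
            (σ-δ-≡ (j ↑ˡ excess nₐ) y)) m)
      ; d-s-suc = λ j T m → resp T (retract
          (λ {nₐ} y → σ-δ-suc (j ↑ˡ excess nₐ) y) m)
      ; d-s-> = λ i j j<i T m → resp T (square
          (λ {nₐ} y → trans
            (cong (λ k → pinch k (punchIn (suc (i ↑ˡ excess nₐ)) y))
              (inject₁-↑ˡ j (excess nₐ)))
            (σ-δ-> (i ↑ˡ excess nₐ) (j ↑ˡ excess nₐ) (↑ˡ-< j i _ j<i) y)) m)
      }
      where
      precomposition : ∀ {p q} (f : Index q → Index p) →
        IsLinear (functionModule R (Index p)) (functionModule R (Index q))
                 (_∘ f)
      precomposition f = linear
        (functionModule R (Index _)) (functionModule R (Index _))
        (λ e m → e (f m)) (λ _ _ _ → R.refl) (λ _ → R.refl)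
        (λ _ _ → R.refl) (λ _ _ _ → R.refl)

{-# OPTIONS --safe #-}

-- In each degree the index set I is finite, so T ⊗ b ↦ (i ↦ b · φ (T i)) has
-- the inverse f ↦ Σₘ Eₘ ⊗ f m; both round trips reduce to the expansion of a
-- function in the basis of indicator functions.  Faces and degeneracies are
-- precompositions, with which θ commutes for any map of index sets.

module Submission where

open import Defs
open import Algebra.Bundles using (AbelianGroup; CommutativeMonoid; CommutativeRing)
open import Algebra.Module.Bundles using (Module)
open import Algebra.Morphism.Bundles using (RingHomomorphism)
import Algebra.Properties.AbelianGroup as AbelianGroupProperties
import Algebra.Properties.CommutativeMonoid.Sum as Sum
import Algebra.Properties.Ring as RingProperties
open import Data.Bool.Base using (if_then_else_)
open import Data.Fin.Base using (Fin; zero; suc)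
open import Data.Fin.Properties using (1↔⊤; *↔×; suc-injective)
open import Data.Nat.Base using (ℕ; zero; suc)
open import Data.Product.Base using (Σ-syntax; ∃-syntax; _×_; _,_; proj₂; uncurry)
open import Data.Product.Function.NonDependent.Propositional using (_×-↔_)
open import Data.Unit.Base using (⊤)
open import Data.Vec.Base using (Vec; []; _∷_)
open import Data.Vec.Relation.Unary.All using (All; []; _∷_; uncons)
open import Function.Base using (_∘_)
open import Function.Bundles using (_↔_; mk↔ₛ′; module Inverse)
open import Function.Construct.Composition using (_↔-∘_)
open import Function.Construct.Identity using (↔-id)
open import Level using (Level)
open import Relation.Binary.Definitions using (DecidableEquality)
open import Relation.Binary.PropositionalEquality.Core as ≡ using (_≡_; _≢_)
open import Relation.Nullary.Decidable using (does; yes; no)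
open import Relation.Nullary.Negation using (contradiction)

-- Finiteness of the index sets.

[]↔ : ∀ {P : ℕ → Set} → ⊤ ↔ All P []
[]↔ = mk↔ₛ′ (λ _ → []) _ (λ { [] → ≡.refl }) (λ _ → ≡.refl)

∷↔ : ∀ {P : ℕ → Set} {n k} {v : Vec ℕ k} → (P n × All P v) ↔ All P (n ∷ v)
∷↔ = mk↔ₛ′ (uncurry _∷_) uncons (λ { (_ ∷ _) → ≡.refl }) (λ _ → ≡.refl)

-- The cardinality is the product of the sizes, built one factor at a time through `*↔×`. It stays
-- existential because only an enumeration is needed.
finite-All : (size : ℕ → ℕ) → ∀ {k} (v : Vec ℕ k) →
             ∃[ N ] Fin N ↔ All (Fin ∘ size) v
finite-All size []      = 1 , []↔ ↔-∘ 1↔⊤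
finite-All size (n ∷ v) =
  _ , ∷↔ ↔-∘ ((↔-id (Fin (size n)) ×-↔ proj₂ (finite-All size v)) ↔-∘ *↔×)

-- Finite sums and expansion in indicator functions.

module _ {c ℓ : Level} (M : CommutativeMonoid c ℓ) where

  open CommutativeMonoid M
  open Sum M using (sum; sum-cong-≋; sum-replicate-zero)

  sum-single : ∀ {n} (t : Fin n → Carrier) k → (∀ j → j ≢ k → t j ≈ ε) →
               sum t ≈ t k
  sum-single {suc n} t zero    off =
    trans (∙-congˡ (trans (sum-cong-≋ (λ j → off (suc j) λ ())) (sum-replicate-zero n)))
      (identityʳ (t zero))
  sum-single         t (suc k) off =
    trans (∙-cong (off zero λ ())
        (sum-single (t ∘ suc) k (λ j j≢k → off (suc j) (j≢k ∘ suc-injective))))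
      (identityˡ (t (suc k)))

module _ {I : Set} (_≟_ : DecidableEquality I) where

  -- For the decidable equality on `Index p` this unfolds to the same term as `E`, so results about
  -- it apply to `E` without conversion.
  indicator : ∀ {r ℓr} (R : CommutativeRing r ℓr) → I → I → CommutativeRing.Carrier R
  indicator R m l = if does (m ≟ l) then R.1# else R.0#
    where module R = CommutativeRing R

  module _ {N : ℕ} (enum : Fin N ↔ I) {r ℓr : Level} (R : CommutativeRing r ℓr) where

    open CommutativeRing R
    open Inverse enum using (to; from; strictlyInverseˡ; strictlyInverseʳ)
    open Sum +-commutativeMonoid using (sum)

    -- Since `to` is a bijection, the only term that survives is the one at `from i`, where the
    -- indicator is `1#`.
    indicator-expansion : ∀ (f : I → Carrier) i →
      sum (λ j → f (to j) * indicator R (to j) i) ≈ f i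
    indicator-expansion f i = trans (sum-single +-commutativeMonoid _ (from i) off) diag
      where
      off : ∀ j → j ≢ from i → f (to j) * indicator R (to j) i ≈ 0#
      off j j≢ with to j ≟ i
      ... | yes eq = contradiction (≡.trans (≡.sym (strictlyInverseʳ j)) (≡.cong from eq)) j≢
      ... | no _   = zeroʳ _
      diag : f (to (from i)) * indicator R (to (from i)) i ≈ f i
      diag with to (from i) ≟ i
      ... | yes eq = trans (*-identityʳ _) (reflexive (≡.cong f eq))
      ... | no neq = contradiction (strictlyInverseˡ i) neq

-- The comparison map and its inverse.

module _ {a ℓa b ℓb : Level} (A : CommutativeRing a ℓa) (B : CommutativeRing b ℓb)
  (φ : RingHomomorphism (CommutativeRing.rawRing A) (CommutativeRing.rawRing B))
  where

  private
    module A = CommutativeRing A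
    module B = CommutativeRing B
    module φ = RingHomomorphism φ

  open BaseChange {A = A} {B = B} φ

  -- An indicator takes only the values `0#` and `1#`, and a ring homomorphism preserves both.
  φ-indicator : ∀ {I : Set} (_≟_ : DecidableEquality I) m l →
                φ.⟦ indicator _≟_ A m l ⟧ B.≈ indicator _≟_ B m l
  φ-indicator _≟_ m l with m ≟ l
  ... | yes _ = φ.1#-homo
  ... | no _  = φ.0#-homo

  module _ (I : Set) where

    private
      M = functionModule A I
      module M = Module M
      module N = Module (functionModule B I)
      module T = TensorProduct M B-as-A-module
      module TG = AbelianGroup T.abelianGroup
      module TS = Sum TG.commutativeMonoid
      module BS = Sum B.+-commutativeMonoid
    open T using (_⊗_; _⊞_; 𝟎; ⊟_; _≋_)

    -- Defined on raw tensor terms; `evaluate-cong` shows that it descends to the tensor product.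
    evaluate : T.Tensor → I → B.Carrier
    evaluate (f ⊗ c) i = c B.* φ.⟦ f i ⟧
    evaluate (t ⊞ u) i = evaluate t i B.+ evaluate u i
    evaluate 𝟎       i = B.0#
    evaluate (⊟ t)   i = B.- evaluate t i

    evaluate-cong : ∀ {t u} → t ≋ u → ∀ i → evaluate t i B.≈ evaluate u i
    evaluate-cong T.≋-refl             i = B.refl
    evaluate-cong (T.≋-sym p)          i = B.sym (evaluate-cong p i)
    evaluate-cong (T.≋-trans p q)      i = B.trans (evaluate-cong p i) (evaluate-cong q i)
    evaluate-cong (T.⊗-cong p q)       i = B.*-cong q (φ.⟦⟧-cong (p i))
    evaluate-cong (T.⊞-cong p q)       i = B.+-cong (evaluate-cong p i) (evaluate-cong q i)
    evaluate-cong (T.⊟-cong p)         i = B.-‿cong (evaluate-cong p i)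
    evaluate-cong (T.⊞-assoc _ _ _)    i = B.+-assoc _ _ _
    evaluate-cong (T.⊞-comm _ _)       i = B.+-comm _ _
    evaluate-cong (T.⊞-identityˡ _)    i = B.+-identityˡ _
    evaluate-cong (T.⊞-inverseˡ _)     i = B.-‿inverseˡ _
    evaluate-cong (T.⊗-distribʳ f g c) i =
      B.trans (B.*-congˡ (φ.+-homo (f i) (g i))) (B.distribˡ c _ _)
    evaluate-cong (T.⊗-distribˡ f c d) i = B.distribʳ φ.⟦ f i ⟧ c d
    -- `A` acts on `B` through `φ`, so multiplicativity of `φ` and commutativity of `B` carry the
    -- scalar `c` across.
    evaluate-cong (T.⊗-balanced c f d) i =
      B.trans (B.*-congˡ (φ.*-homo c (f i)))
        (B.trans (B.sym (B.*-assoc d _ _)) (B.*-congʳ (B.*-comm d _)))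

    evaluate-* : ∀ c t i → evaluate (Module._*ₗ_ (baseChange M) c t) i B.≈ c B.* evaluate t i
    evaluate-* c (f ⊗ d) i = B.*-assoc c d _
    evaluate-* c (t ⊞ u) i =
      B.trans (B.+-cong (evaluate-* c t i) (evaluate-* c u i)) (B.sym (B.distribˡ c _ _))
    evaluate-* c 𝟎       i = B.sym (B.zeroʳ c)
    evaluate-* c (⊟ t)   i =
      B.trans (B.-‿cong (evaluate-* c t i)) (RingProperties.-‿distribʳ-* B.ring c _)

    evaluate-linear : IsLinear (baseChange M) (functionModule B I) evaluate
    evaluate-linear = linear (baseChange M) (functionModule B I) evaluate-cong
      (λ _ _ _ → B.refl) (λ _ → B.refl) (λ _ _ → B.refl) evaluate-*

    evaluate-sum : ∀ {n} (t : Fin n → T.Tensor) i →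
                   evaluate (TS.sum t) i B.≈ BS.sum (λ j → evaluate (t j) i)
    evaluate-sum {zero} t i = B.refl
    evaluate-sum {suc n}  t i = B.+-congˡ (evaluate-sum (t ∘ suc) i)

    -- By additivity in the first slot the element added to itself gives itself, so it vanishes by
    -- cancellation.
    ⊗-zeroˡ : ∀ c → M.0ᴹ ⊗ c ≋ 𝟎
    ⊗-zeroˡ c = AbelianGroupProperties.identityˡ-unique T.abelianGroup _ (M.0ᴹ ⊗ c)
      (T.≋-trans (T.≋-sym (T.⊗-distribʳ M.0ᴹ M.0ᴹ c))
        (T.⊗-cong (M.+ᴹ-identityˡ M.0ᴹ) B.refl))

    ⊗-zeroʳ : ∀ f → f ⊗ B.0# ≋ 𝟎
    ⊗-zeroʳ f = AbelianGroupProperties.identityˡ-unique T.abelianGroup _ (f ⊗ B.0#)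
      (T.≋-trans (T.≋-sym (T.⊗-distribˡ f B.0# B.0#))
        (T.⊗-cong M.≈ᴹ-refl (B.+-identityˡ B.0#)))

    -- The sum of functions is taken pointwise: it then reduces to head `+ᴹ` tail, and it matches
    -- the form of `indicator-expansion`.
    ⊗-distribʳ-sum : ∀ {n} (f : Fin n → I → A.Carrier) c →
      (λ i → Sum.sum A.+-commutativeMonoid (λ j → f j i)) ⊗ c ≋ TS.sum (λ j → f j ⊗ c)
    ⊗-distribʳ-sum {zero} f c = ⊗-zeroˡ c
    ⊗-distribʳ-sum {suc n}  f c =
      T.≋-trans (T.⊗-distribʳ _ _ c) (T.⊞-cong T.≋-refl (⊗-distribʳ-sum (f ∘ suc) c))

    module _ (_≟_ : DecidableEquality I) {N : ℕ} (enum : Fin N ↔ I) where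

      open Inverse enum using (to)

      expand : (I → B.Carrier) → T.Tensor
      expand f = TS.sum (λ j → indicator _≟_ A (to j) ⊗ f (to j))

      expand-cong : ∀ {f g} → f N.≈ᴹ g → expand f ≋ expand g
      expand-cong p = TS.sum-cong-≋ (λ j → T.⊗-cong M.≈ᴹ-refl (p (to j)))

      expand-+ : ∀ f g → expand (f N.+ᴹ g) ≋ expand f ⊞ expand g
      expand-+ f g = T.≋-trans
        (TS.sum-cong-≋ (λ j → T.⊗-distribˡ _ (f (to j)) (g (to j))))
        (TS.∑-distrib-+ (λ j → indicator _≟_ A (to j) ⊗ f (to j)) _)

      expand-0 : expand N.0ᴹ ≋ 𝟎
      expand-0 = T.≋-trans (TS.sum-cong-≋ {N} (λ j → ⊗-zeroʳ (indicator _≟_ A (to j)))) (TS.sum-replicate-zero N)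

      -- Additivity suffices: `expand (N.-ᴹ f)` and `expand f` add up to `expand N.0ᴹ`, which is
      -- `𝟎`.
      expand-neg : ∀ f → expand (N.-ᴹ f) ≋ ⊟ expand f
      expand-neg f = AbelianGroupProperties.inverseˡ-unique T.abelianGroup _ _
        (T.≋-trans (T.≋-sym (expand-+ (N.-ᴹ f) f))
          (T.≋-trans (expand-cong (N.-ᴹ‿inverseˡ f)) expand-0))

      -- `φ` turns the indicators over `A` into those over `B`, leaving the expansion of `f` over
      -- `B`.
      evaluate-expand : ∀ f → evaluate (expand f) N.≈ᴹ f
      evaluate-expand f i =
        B.trans (evaluate-sum (λ j → indicator _≟_ A (to j) ⊗ f (to j)) i)
          (B.trans (BS.sum-cong-≋ (λ j → B.*-congˡ (φ-indicator _≟_ (to j) i)))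
            (indicator-expansion _≟_ enum B f i))

      -- All the content is in pure tensors; the other term formers follow because `expand` is
      -- additive.
      expand-evaluate : ∀ t → expand (evaluate t) ≋ t
      expand-evaluate (f ⊗ c) =
        -- Balancedness moves each value `f (to j)` to the left of the tensor sign; the common
        -- factor `c` is then pulled out and the left factors sum to `f` over `A`.
        T.≋-trans (TS.sum-cong-≋ move)
          (T.≋-trans (T.≋-sym (⊗-distribʳ-sum (λ j → f (to j) M.*ₗ indicator _≟_ A (to j)) c))
            (T.⊗-cong (indicator-expansion _≟_ enum A f) B.refl))
        where
        move : ∀ j → indicator _≟_ A (to j) ⊗ (c B.* φ.⟦ f (to j) ⟧)
                     ≋ (f (to j) M.*ₗ indicator _≟_ A (to j)) ⊗ c
        move j = T.≋-trans (T.⊗-cong M.≈ᴹ-refl (B.*-comm c _))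
                   (T.≋-sym (T.⊗-balanced (f (to j)) _ c))
      expand-evaluate (t ⊞ u) =
        T.≋-trans (expand-+ (evaluate t) (evaluate u))
          (T.⊞-cong (expand-evaluate t) (expand-evaluate u))
      expand-evaluate 𝟎       = expand-0
      expand-evaluate (⊟ t)   =
        T.≋-trans (expand-neg (evaluate t)) (T.⊟-cong (expand-evaluate t))

      evaluate-iso : IsLinearIso (baseChange M) (functionModule B I) evaluate
      evaluate-iso = record
        { isModuleMonomorphism = record
          { isModuleHomomorphism = evaluate-linear
          ; injective = λ {t} {u} p → T.≋-trans (T.≋-sym (expand-evaluate t))
              (T.≋-trans (expand-cong p) (expand-evaluate u))
          }
        -- Surjectivity concerns every tensor equal to the chosen preimage, hence the appeal to
        -- `evaluate-cong`.
        ; surjective = λ f → expand f , λ p →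
            N.≈ᴹ-trans (evaluate-cong p) (evaluate-expand f)
        }

  -- On a pure tensor both sides compute to `c B.* φ.⟦ f (h j) ⟧`; the rest is induction on the
  -- term.
  evaluate-natural : ∀ {I J : Set} (h : J → I) t j →
    evaluate J (baseChangeMap (functionModule A I) (functionModule A J) (_∘ h) t) j
    B.≈ evaluate I t (h j)
  evaluate-natural h (TensorProduct._⊗_ f c) j = B.refl
  evaluate-natural h (TensorProduct._⊞_ t u) j =
    B.+-cong (evaluate-natural h t j) (evaluate-natural h u j)
  evaluate-natural h TensorProduct.𝟎         j = B.refl
  evaluate-natural h (TensorProduct.⊟_ t)    j = B.-‿cong (evaluate-natural h t j)

proposition2p8 : ∀ {a ℓa b ℓb : Level}
    {A : CommutativeRing a ℓa} {B : CommutativeRing b ℓb}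
    (φ : RingHomomorphism (CommutativeRing.rawRing A) (CommutativeRing.rawRing B))
    (shape : Shape) →
    let open Diagonal shape
        module X•B = SimplicialModule (X• B)
        open TensorProduct using (_⊗_)
    in
    Σ[ iso ∈ ((X• A ⊗[ φ ]) ≅ X• B) ]
      (∀ (p : ℕ) (m : Index p) (c : CommutativeRing.Carrier B) →
        _≅_.θ iso p (E A m ⊗ c) X•B.≈ Module._*ₗ_ (X•B.X p) c (E B m))
proposition2p8 {A = A} {B = B} φ shape = record
  { θ     = λ p → evaluate A B φ (Index p)
  ; θ-iso = λ p → evaluate-iso A B φ (Index p) _≟_ (proj₂ (finite-All (λ n → suc (M p n)) sizes))
  ; θ-d   = λ i → evaluate-natural A B φ (Δ i)
  ; θ-s   = λ i → evaluate-natural A B φ (Σ i)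
  -- The left side computes to `c` times `φ` of `E A m l`, so it remains to replace that image by
  -- `E B m l`.
  } , λ p m c l → CommutativeRing.*-congˡ B (φ-indicator A B φ _≟_ m l)
  where
  open Shape shape
  open Diagonal shape
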